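{- Let $\sigma$ be a unimodular morphism of $F_d$, let $\vec{\alpha}\in\mathbb{R}_+^d\setminus\{\vec{0}\}$ and $\rho\in\mathbb{R}$. Then the following three assertions are equivalent: (a) $E_1^*(\sigma)(\mathcal{P}_{\vec{\alpha},\rho})$ is a binary stepped function; (b) $E_1^*(\sigma)(\mathcal{P}_{\vec{\alpha},\rho})$ is equal to the stepped plane $\mathcal{P}_{M_\sigma^\top\vec{\alpha},\rho}$ (this assertion including that $M_\sigma^\top\vec{\alpha}$ is an admissible normal vector of a stepped plane); (c) $M_\sigma^\top\vec{\alpha}\in\mathbb{R}_+^d$.
   Context: Fix an integer $d\geq 3$; $(\vec{e}_1,\ldots,\vec{e}_d)$ is the canonical basis of $\mathbb{R}^d$, $\langle\cdot|\cdot\rangle$ the standard scalar product, $\mathbb{R}_+$ the set of non-negative reals. A stepped function is a function $\mathcal{E}:\mathbb{Z}^d\times\{1,\ldots,d\}\to\mathbb{Z}$; the set of stepped functions is denoted $\mathfrak{F}$. It is binary if it takes only the values $0$ and $1$. The stepped plane of normal vector $\vec{\alpha}\in\mathbb{R}_+^d\setminus\{\vec{0}\}$ and intercept $\rho\in\mathbb{R}$ is the binary stepped function $\mathcal{P}_{\vec{\alpha},\rho}$ such that $\mathcal{P}_{\vec{\alpha},\rho}(\vec{x},i)=1$ if and only if $\langle\vec{x}|\vec{\alpha}\rangle<\rho\leq\langle\vec{x}+\vec{e}_i|\vec{\alpha}\rangle$. $F_d$ is the free group on the alphabet $\{1,\ldots,d\}$; its elements are written in reduced form. The Abelianization map $\vec{f}:F_d\to\mathbb{Z}^d$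 sends $w$ to the vector whose $i$-th entry is the sum of the exponents of the occurrences of $i$ in $w$. A morphism $\sigma$ of $F_d$ is a group endomorphism; its incidence matrix $M_\sigma$ is the $d\times d$ integer matrix whose $i$-th column is $\vec{f}(\sigma(i))$; $\sigma$ is unimodular if $\det M_\sigma=\pm 1$. The dual map $E_1^*(\sigma):\mathfrak{F}\to\mathfrak{F}$ of a unimodular morphism $\sigma$ is defined by $$E_1^*(\sigma)(\mathcal{E})(\vec{x},i)=\sum_{\sigma(i)=p\cdot j\cdot s}\mathcal{E}(M_\sigma\vec{x}+\vec{f}(p),j)-\sum_{\sigma(i)=p\cdot j^{ -1}\cdot s}\mathcal{E}(M_\sigma\vec{x}+\vec{f}(p)-\vec{e}_j,j),$$ where the first (resp. second) sum ranges over all occurrences in the reduced word $\sigma(i)$ of letters $j$ (resp. inverse letters $j^{ -1}$), $1\leq j\leq d$, with $p$ the prefix before and $s$ the suffix after that occurrence. -}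

module Defs where

open import Algebra.Bundles using (CommutativeRing; Group)
open import Algebra.Morphism.Bundles using (GroupHomomorphism)
open import Algebra.Structures using (IsCommutativeRing)
import Algebra.Definitions.RawMonoid as RawMonoidDefs
import Algebra.Properties.Semiring.Sum as SemiringSum
open import Data.Bool.Base using (if_then_else_)
open import Data.Fin.Base using (Fin; zero; suc; toℕ; punchIn)
import Data.Fin.Properties as Fin
open import Data.Integer.Base using (ℤ; +_; -[1+_]; 0ℤ; 1ℤ; -1ℤ; _+_; _*_; _-_; _^_; _◃_)
import Data.Integer.Properties as ℤ
open import Data.List.Base as List using (List; []; _∷_; [_]; _++_; foldr; map; filter; reverse; take; length)
import Data.List.Properties as List
open import Data.List.Relation.Unary.Linked as Linked using (Linked; []; [-]; _∷_)
open import Data.Nat.Base using (ℕ; zero; suc)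
open import Data.Product.Base using (∃; _×_; _,_; proj₁)
import Data.Product.Properties as Product
open import Data.Sign.Base as Sign using (Sign)
import Data.Sign.Properties as Sign
open import Data.Sum.Base using (_⊎_)
open import Data.Vec.Base as Vec using (Vec; tabulate; zipWith)
open import Data.Vec.Functional using (Vector)
open import Level using (0ℓ)
open import Relation.Binary.Core using (Rel)
open import Relation.Binary.Definitions using (DecidableEquality; Decidable)
open import Relation.Binary.Structures using (IsDecTotalOrder)
import Relation.Binary.Construct.NonStrictToStrict as ToStrict
open import Relation.Binary.PropositionalEquality
  using (_≡_; _≢_; refl; sym; trans; cong; cong₂; subst; module ≡-Reasoning)
open import Relation.Nullary using (¬_; yes; no; does; contradiction)
open import Relation.Nullary.Decidable using (_×-dec_)
open import Relation.Unary using (Pred)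

-- The real numbers, given by their classical characterisation as the
-- (unique up to isomorphism) Dedekind-complete ordered field.  The order
-- is decidable, as it is classically: a stepped plane is an integer-valued
-- function whose values depend on comparisons of real numbers.
record Reals : Set₁ where
  infix  4 _≈_ _≤_
  infixl 6 _+ᴿ_
  infixl 7 _*ᴿ_
  field
    Carrier           : Set
    _≈_               : Rel Carrier 0ℓ
    _≤_               : Rel Carrier 0ℓ
    _+ᴿ_              : Carrier → Carrier → Carrier
    _*ᴿ_              : Carrier → Carrier → Carrier
    -ᴿ_               : Carrier → Carrier
    0ᴿ                : Carrier
    1ᴿ                : Carrier
    isCommutativeRing : IsCommutativeRing _≈_ _+ᴿ_ _*ᴿ_ -ᴿ_ 0ᴿ 1ᴿ
    isDecTotalOrder   : IsDecTotalOrder _≈_ _≤_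
    0≉1               : ¬ (0ᴿ ≈ 1ᴿ)
    inverse           : ∀ x → ¬ (x ≈ 0ᴿ) → ∃ λ y → x *ᴿ y ≈ 1ᴿ
    +-monoˡ-≤         : ∀ {x y} z → x ≤ y → (x +ᴿ z) ≤ (y +ᴿ z)
    *-nonNeg          : ∀ {x y} → 0ᴿ ≤ x → 0ᴿ ≤ y → 0ᴿ ≤ (x *ᴿ y)

  UpperBound : Pred Carrier 0ℓ → Carrier → Set
  UpperBound S b = ∀ x → S x → x ≤ b

  field
    supremum : (S : Pred Carrier 0ℓ) → ∃ S → ∃ (UpperBound S) →
               ∃ λ s → UpperBound S s × (∀ b → UpperBound S b → s ≤ b)

  commutativeRing : CommutativeRing 0ℓ 0ℓ
  commutativeRing = record { isCommutativeRing = isCommutativeRing }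

  open IsDecTotalOrder isDecTotalOrder public using (_≤?_; _≟_)
  open ToStrict _≈_ _≤_ public using (_<_)

  _<?_ : Decidable _<_
  _<?_ = ToStrict.<-decidable _≈_ _≤_ _≟_ _≤?_

  open SemiringSum (CommutativeRing.semiring commutativeRing) public using (sum)
  open RawMonoidDefs (CommutativeRing.+-rawMonoid commutativeRing) public
    using () renaming (_×_ to _×ᴿ_)

  fromℤ : ℤ → Carrier
  fromℤ (+ n)    = n ×ᴿ 1ᴿ
  fromℤ -[1+ n ] = -ᴿ (suc n ×ᴿ 1ᴿ)

open SemiringSum ℤ.+-*-semiring using () renaming (sum to sumℤ)

Matrix : ℕ → Set
Matrix n = Fin n → Fin n → ℤ

-- Laplace expansion along the first row.
det : ∀ {n} → Matrix n → ℤ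
det {zero}  M = 1ℤ
det {suc n} M = sumℤ λ j →
  -1ℤ ^ toℕ j * M zero j * det (λ r c → M (suc r) (punchIn j c))

-- Points of ℤ^d are first-order vectors, so that propositional equality is
-- equality of points and every function on them respects it.
ℤ^ : ℕ → Set
ℤ^ d = Vec ℤ d

infixl 6 _⊕_ _⊖_
infixl 7 _·_

_⊕_ _⊖_ : ∀ {d} → ℤ^ d → ℤ^ d → ℤ^ d
_⊕_ = zipWith _+_
_⊖_ = zipWith _-_

e : ∀ {d} → Fin d → ℤ^ d
e i = tabulate λ k → if does (k Fin.≟ i) then 1ℤ else 0ℤ

_·_ : ∀ {d} → Matrix d → ℤ^ d → ℤ^ d
M · x = tabulate λ i → sumℤ λ j → M i j * Vec.lookup x j

-- (j , Sign.+) is the letter j and (j , Sign.-) the inverse letter j⁻¹.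
Letter : ℕ → Set
Letter d = Fin d × Sign

inv : ∀ {d} → Letter d → Letter d
inv (j , s) = j , Sign.opposite s

_≟ᴸ_ : ∀ {d} → DecidableEquality (Letter d)
_≟ᴸ_ = Product.≡-dec Fin._≟_ Sign._≟_

inv-involutive : ∀ {d} (a : Letter d) → inv (inv a) ≡ a
inv-involutive (j , s) = cong (j ,_) (Sign.opposite-involutive s)

Reduced : ∀ {d} → List (Letter d) → Set
Reduced = Linked λ a b → b ≢ inv a

push : ∀ {d} → Letter d → List (Letter d) → List (Letter d)
push a []      = [ a ]
push a (b ∷ w) with b ≟ᴸ inv a
... | yes _ = w
... | no  _ = a ∷ b ∷ w

reduce : ∀ {d} → List (Letter d) → List (Letter d)
reduce = foldr push []

push-reduced : ∀ {d} (a : Letter d) {w} → Reduced w → Reduced (push a w)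
push-reduced a {[]}    _ = [-]
push-reduced a {b ∷ w} r with b ≟ᴸ inv a
... | yes _   = Linked.tail r
... | no  b≢a = b≢a ∷ r

reduce-reduced : ∀ {d} (w : List (Letter d)) → Reduced (reduce w)
reduce-reduced []      = []
reduce-reduced (a ∷ w) = push-reduced a (reduce-reduced w)

push-∷ : ∀ {d} (a : Letter d) {w} → Reduced (a ∷ w) → push a w ≡ a ∷ w
push-∷ a {[]}    _ = refl
push-∷ a {b ∷ w} r with b ≟ᴸ inv a
... | yes b≡a = contradiction b≡a (Linked.head r)
... | no  _   = refl

reduce-id : ∀ {d} {w : List (Letter d)} → Reduced w → reduce w ≡ w
reduce-id {w = []}    _ = refl
reduce-id {w = a ∷ w} r =
  trans (cong (push a) (reduce-id (Linked.tail r))) (push-∷ a r)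

push-cancel : ∀ {d} (a : Letter d) {b w} → b ≡ inv a → push a (b ∷ w) ≡ w
push-cancel a {b} b≡a with b ≟ᴸ inv a
... | yes _   = refl
... | no  b≢a = contradiction b≡a b≢a

push-push-inv : ∀ {d} (a : Letter d) {w} → Reduced w → push a (push (inv a) w) ≡ w
push-push-inv a {[]}    _ = push-cancel a refl
push-push-inv a {b ∷ w} r with b ≟ᴸ inv (inv a)
... | no  _ = push-cancel a refl
... | yes b≡a with refl ← trans b≡a (inv-involutive a) = push-∷ a r

reduce-push-++ : ∀ {d} (a : Letter d) u v →
                 reduce (push a u ++ v) ≡ push a (reduce (u ++ v))
reduce-push-++ a []      v = refl
reduce-push-++ a (b ∷ u) v with b ≟ᴸ inv a
... | no  _    = refl
... | yes refl = sym (push-push-inv a (reduce-reduced (u ++ v)))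

reduce-++ˡ : ∀ {d} (u v : List (Letter d)) → reduce (reduce u ++ v) ≡ reduce (u ++ v)
reduce-++ˡ []      v = refl
reduce-++ˡ (a ∷ u) v =
  trans (reduce-push-++ a (reduce u) v) (cong (push a) (reduce-++ˡ u v))

reduce-++ʳ : ∀ {d} (u v : List (Letter d)) → reduce (u ++ reduce v) ≡ reduce (u ++ v)
reduce-++ʳ []      v = reduce-id (reduce-reduced v)
reduce-++ʳ (a ∷ u) v = cong (push a) (reduce-++ʳ u v)

inverseWord : ∀ {d} → List (Letter d) → List (Letter d)
inverseWord w = reverse (map inv w)

inverseWord-∷ : ∀ {d} (a : Letter d) u v →
                inverseWord (a ∷ u) ++ v ≡ inverseWord u ++ inv a ∷ v
inverseWord-∷ a u v = trans
  (cong (_++ v) (List.unfold-reverse (inv a) (map inv u)))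
  (List.++-assoc (inverseWord u) [ inv a ] v)

reduce-inverseˡ : ∀ {d} (u v : List (Letter d)) →
                  reduce (inverseWord u ++ u ++ v) ≡ reduce v
reduce-inverseˡ []      v = refl
reduce-inverseˡ (a ∷ u) v = begin
  reduce (inverseWord (a ∷ u) ++ a ∷ u ++ v)            ≡⟨ cong reduce (inverseWord-∷ a u _) ⟩
  reduce (inverseWord u ++ inv a ∷ a ∷ u ++ v)          ≡⟨ reduce-++ʳ (inverseWord u) _ ⟨
  reduce (inverseWord u ++ reduce (inv a ∷ a ∷ u ++ v)) ≡⟨ cong (λ z → reduce (inverseWord u ++ z)) step ⟩
  reduce (inverseWord u ++ reduce (u ++ v))             ≡⟨ reduce-++ʳ (inverseWord u) _ ⟩
  reduce (inverseWord u ++ u ++ v)                      ≡⟨ reduce-inverseˡ u v ⟩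
  reduce v                                              ∎
  where
  open ≡-Reasoning
  step : reduce (inv a ∷ a ∷ u ++ v) ≡ reduce (u ++ v)
  step = subst (λ b → push (inv a) (push b (reduce (u ++ v))) ≡ reduce (u ++ v))
    (inv-involutive a) (push-push-inv (inv a) (reduce-reduced (u ++ v)))

reduce-inverseʳ : ∀ {d} (u v : List (Letter d)) →
                  reduce (u ++ inverseWord u ++ v) ≡ reduce v
reduce-inverseʳ []      v = refl
reduce-inverseʳ (a ∷ u) v = begin
  push a (reduce (u ++ inverseWord (a ∷ u) ++ v))   ≡⟨ cong (λ z → push a (reduce (u ++ z))) (inverseWord-∷ a u v) ⟩
  push a (reduce (u ++ inverseWord u ++ inv a ∷ v)) ≡⟨ cong (push a) (reduce-inverseʳ u (inv a ∷ v)) ⟩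
  push a (push (inv a) (reduce v))                  ≡⟨ push-push-inv a (reduce-reduced v) ⟩
  reduce v                                          ∎
  where open ≡-Reasoning

record ReducedWord (d : ℕ) : Set where
  constructor _,_
  field
    letters : List (Letter d)
    reduced : Reduced letters

open ReducedWord public

⟨_⟩ : ∀ {d} → List (Letter d) → ReducedWord d
⟨ w ⟩ = reduce w , reduce-reduced w

freeGroup : ℕ → Group 0ℓ 0ℓ
freeGroup d = record
  { Carrier = ReducedWord d
  ; _≈_     = λ u v → letters u ≡ letters v
  ; _∙_     = λ u v → ⟨ letters u ++ letters v ⟩
  ; ε       = [] , []
  ; _⁻¹     = λ u → ⟨ inverseWord (letters u) ⟩
  ; isGroup = record
    { isMonoid = record
      { isSemigroup = record
        { isMagma = record
          { isEquivalence = record { refl = refl ; sym = sym ; trans = trans }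
          ; ∙-cong        = cong₂ (λ u v → reduce (u ++ v))
          }
        ; assoc = λ u v w → assoc (letters u) (letters v) (letters w)
        }
      ; identity = (λ u → reduce-id (reduced u))
                 , (λ u → trans (cong reduce (List.++-identityʳ (letters u))) (reduce-id (reduced u)))
      }
    ; inverse = (λ u → inverseˡ (letters u)) , (λ u → inverseʳ (letters u))
    ; ⁻¹-cong = cong (λ u → reduce (inverseWord u))
    }
  }
  where
  assoc : (u v w : List (Letter d)) →
          reduce (reduce (u ++ v) ++ w) ≡ reduce (u ++ reduce (v ++ w))
  assoc u v w = trans (reduce-++ˡ (u ++ v) w)
    (trans (cong reduce (List.++-assoc u v w)) (sym (reduce-++ʳ u (v ++ w))))

  inverseˡ : (u : List (Letter d)) → reduce (reduce (inverseWord u) ++ u) ≡ []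
  inverseˡ u = trans (reduce-++ˡ (inverseWord u) u)
    (trans (cong (λ z → reduce (inverseWord u ++ z)) (sym (List.++-identityʳ u)))
           (reduce-inverseˡ u []))

  inverseʳ : (u : List (Letter d)) → reduce (u ++ reduce (inverseWord u)) ≡ []
  inverseʳ u = trans (reduce-++ʳ u (inverseWord u))
    (trans (cong (λ z → reduce (u ++ z)) (sym (List.++-identityʳ (inverseWord u))))
           (reduce-inverseʳ u []))

generator : ∀ {d} → Fin d → ReducedWord d
generator i = [ i , Sign.+ ] , [-]

Morphism : ℕ → Set
Morphism d = GroupHomomorphism (Group.rawGroup (freeGroup d)) (Group.rawGroup (freeGroup d))

image : ∀ {d} → Morphism d → Fin d → List (Letter d)
image σ i = letters (GroupHomomorphism.⟦_⟧ σ (generator i))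

exponent : ∀ {d} → Letter d → ℤ
exponent (_ , s) = s ◃ 1

-- Defined on all words; on reduced ones it is the Abelianization map of the
-- free group.  Prefixes of reduced words are words.
f : ∀ {d} → List (Letter d) → ℤ^ d
f w = tabulate λ i →
  foldr _+_ 0ℤ (map exponent (filter (λ a → proj₁ a Fin.≟ i) w))

incidence : ∀ {d} → Morphism d → Matrix d
incidence σ i j = Vec.lookup (f (image σ j)) i

Unimodular : ∀ {d} → Morphism d → Set
Unimodular σ = det (incidence σ) ≡ 1ℤ ⊎ det (incidence σ) ≡ -1ℤ

SteppedFunction : ℕ → Set
SteppedFunction d = ℤ^ d → Fin d → ℤ

infix 4 _≐_

_≐_ : ∀ {d} → SteppedFunction d → SteppedFunction d → Set
E ≐ F = ∀ x i → E x i ≡ F x i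

Binary : ∀ {d} → SteppedFunction d → Set
Binary E = ∀ x i → E x i ≡ 0ℤ ⊎ E x i ≡ 1ℤ

-- Contributions of one occurrence of a letter to the two sums of the dual
-- map; y stands for M_σ x + f(p).
positiveTerm negativeTerm : ∀ {d} → SteppedFunction d → Letter d → ℤ^ d → ℤ
positiveTerm E (j , Sign.+) y = E y j
positiveTerm E (j , Sign.-) y = 0ℤ
negativeTerm E (j , Sign.+) y = 0ℤ
negativeTerm E (j , Sign.-) y = E (y ⊖ e j) j

-- The occurrences in σ(i) = p · a · s are indexed by the position k of a.
E₁* : ∀ {d} → Morphism d → SteppedFunction d → SteppedFunction d
E₁* {d} σ E x i =
  sumℤ (λ k → positiveTerm E (List.lookup w k) (y k)) -
  sumℤ (λ k → negativeTerm E (List.lookup w k) (y k))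
  where
  w : List (Letter d)
  w = image σ i

  y : Fin (length w) → ℤ^ d
  y k = incidence σ · x ⊕ f (take (toℕ k) w)

module SteppedPlanes (ℝ : Reals) where
  open Reals ℝ

  ℝ^ : ℕ → Set
  ℝ^ d = Vector Carrier d

  ⟨_∣_⟩ : ∀ {d} → ℤ^ d → ℝ^ d → Carrier
  ⟨ x ∣ α ⟩ = sum λ i → fromℤ (Vec.lookup x i) *ᴿ α i

  NonNegative : ∀ {d} → ℝ^ d → Set
  NonNegative α = ∀ i → 0ᴿ ≤ α i

  NonZero : ∀ {d} → ℝ^ d → Set
  NonZero α = ¬ (∀ i → α i ≈ 0ᴿ)

  IsNormal : ∀ {d} → ℝ^ d → Set
  IsNormal α = NonNegative α × NonZero α

  steppedPlane : ∀ {d} (α : ℝ^ d) → IsNormal α → Carrier → SteppedFunction d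
  steppedPlane α _ ρ x i =
    if does ((⟨ x ∣ α ⟩ <? ρ) ×-dec (ρ ≤? ⟨ x ⊕ e i ∣ α ⟩)) then 1ℤ else 0ℤ

  infixl 7 _ᵀ·_

  _ᵀ·_ : ∀ {d} → Matrix d → ℝ^ d → ℝ^ d
  (M ᵀ· α) i = sum λ j → fromℤ (M j i) *ᴿ α j

{-# OPTIONS --safe #-}
module Submission where

-- For α ≥ 0 the stepped plane is the discrete gradient of the indicator χ of
-- {y | ⟨y∣α⟩ < ρ}: P(y, j) = χ(y) − χ(y + e_j).  The sum defining the dual map then
-- telescopes along the word σ(i), which gives, for β = Mᵀα,
--   E₁*(σ)(P)(x, i) = [⟨x∣β⟩ < ρ] − [⟨x + e_i∣β⟩ < ρ].
-- If β ≥ 0 this is the stepped plane of β, which is nonzero because det M = ±1.  If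
-- β_i < 0, the archimedean property yields an x at which the value is −1.

open import Defs
open import Algebra.Bundles using (CommutativeRing)
import Algebra.Properties.Ring as RingProperties
import Algebra.Properties.Semiring.Mult as SemiringMult
import Algebra.Properties.Semiring.Sum as SemiringSum
open import Data.Bool.Base using (true; false; if_then_else_)
open import Data.Empty using (⊥)
open import Data.Fin.Base using (Fin; zero; suc; toℕ; punchIn; pinch)
import Data.Fin.Properties as Fin
open import Data.Integer.Base as ℤ using (ℤ; -[1+_]; 0ℤ; 1ℤ; -1ℤ; _+_; _*_; _-_; -_; _^_)
import Data.Integer.Properties as ℤ
import Data.Integer.Tactic.RingSolver as ℤ-Solver
open import Data.List.Base as List using (List; []; _∷_; [_]; map; filter; foldr; take; length)
open import Data.Nat.Base as ℕ using (ℕ; zero; suc) renaming (_≤_ to _≤ℕ_)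
import Data.Nat.Properties as ℕ
open import Data.Product.Base using (Σ; ∃; _×_; _,_; proj₁; proj₂)
import Data.Sign.Base as Sign
open import Data.Sum.Base using (_⊎_; inj₁; inj₂)
open import Data.Vec.Base using (lookup; replicate)
import Data.Vec.Properties as Vec
open import Data.Vec.Relation.Binary.Pointwise.Extensional using (ext; Pointwise-≡⇒≡)
open import Data.Vec.Functional using (Vector; removeAt) renaming (_∷_ to infixr 5 _∷ᵛ_)
open import Function.Base using (_∘_)
open import Function.Bundles using (_⇔_; mk⇔)
import Relation.Binary.Construct.NonStrictToStrict as ToStrict
open import Relation.Binary.PropositionalEquality
  using (_≡_; refl; sym; trans; cong; cong₂; subst; module ≡-Reasoning)
import Relation.Binary.Reasoning.Setoid as SetoidReasoning
open import Relation.Binary.Structures using (IsDecTotalOrder)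
open import Relation.Nullary using (Dec; ¬_; yes; no; does; contradiction)
open import Relation.Nullary.Decidable using (_×-dec_; dec-true; dec-false; decidable-stable)

-- Finite integer sums and ordered pairs of distinct indices.

private module Σℤ = SemiringSum ℤ.+-*-semiring
open Σℤ using () renaming (sum to sumℤ)

sumℤ-neg : ∀ {n} (t : Vector ℤ n) → sumℤ (λ i → - t i) ≡ - sumℤ t
sumℤ-neg {zero}  t = refl
sumℤ-neg {suc n} t =
  trans (cong (- t zero +_) (sumℤ-neg (t ∘ suc))) (sym (ℤ.neg-distrib-+ (t zero) _))

-- (j , l) ↦ (punchIn j l , pinch l j) is the involution of Fin (suc n) × Fin n
-- which exchanges the two entries of an ordered pair (j , punchIn j l) of
-- distinct indices.
sumℤ-swap-pairs : ∀ {n} (g : Fin (suc n) → Fin n → ℤ) →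
  sumℤ (λ j → sumℤ (g j)) ≡ sumℤ (λ j → sumℤ (λ l → g (punchIn j l) (pinch l j)))
sumℤ-swap-pairs {zero}  g = refl
sumℤ-swap-pairs {suc n} g = begin
  -- `A` collects the pairs whose first entry is `zero`, `B` those whose second entry is `zero`. The
  -- involution exchanges these two families, and the pairs avoiding `zero` are left to the
  -- induction.
  A + sumℤ (λ j → g (suc j) zero + sumℤ (λ l → g (suc j) (suc l)))
    ≡⟨ cong (A +_) (Σℤ.∑-distrib-+ (λ j → g (suc j) zero) (λ j → sumℤ (λ l → g (suc j) (suc l)))) ⟩
  A + (B + sumℤ (λ j → sumℤ (λ l → g (suc j) (suc l))))
    ≡⟨ cong (λ z → A + (B + z)) (sumℤ-swap-pairs (λ j l → g (suc j) (suc l))) ⟩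
  A + (B + C)
    ≡⟨ exchange A B C ⟩
  B + (A + C)
    ≡⟨ cong (B +_) (Σℤ.∑-distrib-+ (g zero) (λ j → sumℤ (λ l → g (suc (punchIn j l)) (suc (pinch l j))))) ⟨
  B + sumℤ (λ j → g zero j + sumℤ (λ l → g (suc (punchIn j l)) (suc (pinch l j)))) ∎
  where
  open ≡-Reasoning
  exchange : ∀ a b c → a + (b + c) ≡ b + (a + c)
  exchange = ℤ-Solver.solve-∀
  A = sumℤ (g zero)
  B = sumℤ (λ j → g (suc j) zero)
  C = sumℤ (λ j → sumℤ (λ l → g (suc (punchIn j l)) (suc (pinch l j))))

punchIn-pinch : ∀ {n} (j : Fin (suc n)) (l : Fin n) → punchIn (punchIn j l) (pinch l j) ≡ j
punchIn-pinch zero    zero    = refl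
punchIn-pinch zero    (suc l) = refl
punchIn-pinch (suc j) zero    = refl
punchIn-pinch (suc j) (suc l) = cong suc (punchIn-pinch j l)

-- Both sides enumerate, in increasing order, the columns other than `j` and `punchIn j l`. Hence
-- the double minors left by deleting two columns do not depend on the order of deletion.
punchIn-punchIn : ∀ {n} (j : Fin (suc (suc n))) (l : Fin (suc n)) (c : Fin n) →
  punchIn (punchIn j l) (punchIn (pinch l j) c) ≡ punchIn j (punchIn l c)
punchIn-punchIn zero    l       c       = refl
punchIn-punchIn (suc j) zero    c       = refl
punchIn-punchIn (suc j) (suc l) zero    = refl
punchIn-punchIn (suc j) (suc l) (suc c) = cong suc (punchIn-punchIn j l c)

-- The sum of the exponents changes by exactly one: the new pair is (l, j - 1) when l < j, and (l +
-- 1, j) otherwise.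
sign-swap : ∀ {n} (j : Fin (suc n)) (l : Fin n) →
  -1ℤ ^ toℕ (punchIn j l) * -1ℤ ^ toℕ (pinch l j) ≡ - (-1ℤ ^ toℕ j * -1ℤ ^ toℕ l)
sign-swap zero    zero    = refl
sign-swap zero    (suc l) = lemma (-1ℤ ^ toℕ l)
  where
  lemma : ∀ a → -1ℤ * (-1ℤ * a) * 1ℤ ≡ - (1ℤ * (-1ℤ * a))
  lemma = ℤ-Solver.solve-∀
sign-swap (suc j) zero    = lemma (-1ℤ ^ toℕ j)
  where
  lemma : ∀ a → 1ℤ * a ≡ - (-1ℤ * a * 1ℤ)
  lemma = ℤ-Solver.solve-∀
sign-swap (suc j) (suc l) = lemma
  (-1ℤ ^ toℕ (punchIn j l)) (-1ℤ ^ toℕ (pinch l j)) (-1ℤ ^ toℕ j) (-1ℤ ^ toℕ l) (sign-swap j l)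
  where
  square : ∀ a b → -1ℤ * a * (-1ℤ * b) ≡ a * b
  square = ℤ-Solver.solve-∀
  lemma : ∀ a b c d → a * b ≡ - (c * d) → -1ℤ * a * (-1ℤ * b) ≡ - (-1ℤ * c * (-1ℤ * d))
  lemma a b c d eq = trans (square a b) (trans eq (cong -_ (sym (square c d))))

-- Determinants: row exchanges and repeated rows.

det-cong : ∀ {n} {M N : Matrix n} → (∀ r c → M r c ≡ N r c) → det M ≡ det N
det-cong {zero}  eq = refl
det-cong {suc n} eq = Σℤ.sum-cong-≗ λ j →
  cong₂ (λ a b → -1ℤ ^ toℕ j * a * b) (eq zero j) (det-cong λ r c → eq (suc r) (punchIn j c))

deleteColumn : ∀ {m n} → Fin (suc n) → Vector (Vector ℤ (suc n)) m → Vector (Vector ℤ n) m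
deleteColumn j N r = removeAt (N r) j

-- Expanding along the first two rows gives a sum over ordered pairs of distinct columns. Exchanging
-- the two columns of a pair keeps the complementary minor and flips the sign.
det-swap : ∀ {n} (u v : Vector ℤ (suc (suc n))) (N : Vector (Vector ℤ (suc (suc n))) n) →
  det (u ∷ᵛ v ∷ᵛ N) ≡ - det (v ∷ᵛ u ∷ᵛ N)
det-swap {n} u v N = begin
  det (u ∷ᵛ v ∷ᵛ N)
    ≡⟨ expand u v ⟩
  sumℤ (λ j → sumℤ (G u v j))
    ≡⟨ sumℤ-swap-pairs (G u v) ⟩
  sumℤ (λ j → sumℤ (λ l → G u v (punchIn j l) (pinch l j)))
    ≡⟨ Σℤ.sum-cong-≗ (λ j → Σℤ.sum-cong-≗ (G-swap j)) ⟩
  sumℤ (λ j → sumℤ (λ l → - G v u j l))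
    ≡⟨ Σℤ.sum-cong-≗ (λ j → sumℤ-neg (G v u j)) ⟩
  sumℤ (λ j → - sumℤ (G v u j))
    ≡⟨ sumℤ-neg (λ j → sumℤ (G v u j)) ⟩
  - sumℤ (λ j → sumℤ (G v u j))
    ≡⟨ cong -_ (expand v u) ⟨
  - det (v ∷ᵛ u ∷ᵛ N) ∎
  where
  open ≡-Reasoning
  Q : Fin (suc (suc n)) → Fin (suc n) → ℤ
  Q j l = det (deleteColumn l (deleteColumn j N))

  G : (u v : Vector ℤ (suc (suc n))) → Fin (suc (suc n)) → Fin (suc n) → ℤ
  G u v j l = -1ℤ ^ toℕ j * u j * (-1ℤ ^ toℕ l * v (punchIn j l) * Q j l)

  expand : ∀ u v → det (u ∷ᵛ v ∷ᵛ N) ≡ sumℤ (λ j → sumℤ (G u v j))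
  expand u v = Σℤ.sum-cong-≗ λ j →
    Σℤ.*-distribˡ-sum (-1ℤ ^ toℕ j * u j) (λ l → -1ℤ ^ toℕ l * v (punchIn j l) * Q j l)

  G-swap : ∀ j l → G u v (punchIn j l) (pinch l j) ≡ - G v u j l
  G-swap j l = trans
    (cong₂ (λ k q → -1ℤ ^ toℕ (punchIn j l) * u (punchIn j l) * (-1ℤ ^ toℕ (pinch l j) * v k * q))
      (punchIn-pinch j l)
      (det-cong λ r c → cong (N r) (punchIn-punchIn j l c)))
    (lemma (-1ℤ ^ toℕ (punchIn j l)) (-1ℤ ^ toℕ (pinch l j)) (-1ℤ ^ toℕ j) (-1ℤ ^ toℕ l)
      (u (punchIn j l)) (v j) (Q j l) (sign-swap j l))
    where
    regroup : ∀ a b x y q → a * x * (b * y * q) ≡ a * b * (x * y * q)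
    regroup = ℤ-Solver.solve-∀
    regroup′ : ∀ c d x y q → - (c * d) * (x * y * q) ≡ - (c * y * (d * x * q))
    regroup′ = ℤ-Solver.solve-∀
    lemma : ∀ a b c d x y q → a * b ≡ - (c * d) →
            a * x * (b * y * q) ≡ - (c * y * (d * x * q))
    lemma a b c d x y q eq = trans (regroup a b x y q)
      (trans (cong (_* (x * y * q)) eq) (regroup′ c d x y q))

mutual
  -- Row `suc k` first travels to the second place, which costs the sign of `k`; one exchange of the
  -- top two rows supplies the missing factor -1.
  det-moveToFront : ∀ {n} (M : Matrix (suc n)) (k : Fin (suc n)) →
    det M ≡ -1ℤ ^ toℕ k * det (M k ∷ᵛ removeAt M k)
  det-moveToFront         M zero    = sym (ℤ.*-identityˡ (det M))
  det-moveToFront {suc n} M (suc k) = begin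
    det M                                      ≡⟨ det-moveToSecond (M zero) N k ⟩
    s * det (M zero ∷ᵛ N k ∷ᵛ removeAt N k)    ≡⟨ cong (s *_) (det-swap (M zero) (N k) (removeAt N k)) ⟩
    s * - det (N k ∷ᵛ M zero ∷ᵛ removeAt N k)  ≡⟨ lemma s (det (N k ∷ᵛ M zero ∷ᵛ removeAt N k)) ⟩
    -1ℤ * s * det (N k ∷ᵛ M zero ∷ᵛ removeAt N k)
      ≡⟨ cong (-1ℤ * s *_) (det-cong {M = N k ∷ᵛ M zero ∷ᵛ removeAt N k} rows) ⟩
    -1ℤ * s * det (N k ∷ᵛ removeAt M (suc k))  ∎
    where
    open ≡-Reasoning
    N = M ∘ suc
    s = -1ℤ ^ toℕ k
    lemma : ∀ a b → a * - b ≡ -1ℤ * a * b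
    lemma = ℤ-Solver.solve-∀
    rows : ∀ r c → (N k ∷ᵛ M zero ∷ᵛ removeAt N k) r c ≡ (N k ∷ᵛ removeAt M (suc k)) r c
    rows zero          c = refl
    rows (suc zero)    c = refl
    rows (suc (suc r)) c = refl

  -- Expansion along the fixed first row `v` turns this into `det-moveToFront` for each minor, which
  -- has one row fewer; this makes the mutual recursion terminate.
  det-moveToSecond : ∀ {n} (v : Vector ℤ (suc (suc n))) (N : Vector (Vector ℤ (suc (suc n))) (suc n))
    (k : Fin (suc n)) → det (v ∷ᵛ N) ≡ -1ℤ ^ toℕ k * det (v ∷ᵛ N k ∷ᵛ removeAt N k)
  det-moveToSecond v N k = trans
    (Σℤ.sum-cong-≗ λ j → trans
      (cong (-1ℤ ^ toℕ j * v j *_) (det-moveToFront (deleteColumn j N) k))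
      (lemma (-1ℤ ^ toℕ j * v j) s (minor j)))
    (sym (Σℤ.*-distribˡ-sum s (λ j → -1ℤ ^ toℕ j * v j * minor j)))
    where
    s = -1ℤ ^ toℕ k
    minor : Fin _ → ℤ
    minor j = det (deleteColumn j (N k ∷ᵛ removeAt N k))
    lemma : ∀ a s b → a * (s * b) ≡ s * (a * b)
    lemma = ℤ-Solver.solve-∀

-- Once the two equal rows are adjacent at the top, exchanging them shows the determinant to be its
-- own negative.
det-repeatedRow : ∀ {n} (N : Vector (Vector ℤ (suc n)) n) (k : Fin n) → det (N k ∷ᵛ N) ≡ 0ℤ
det-repeatedRow {suc n} N k = begin
  det (N k ∷ᵛ N)                        ≡⟨ det-moveToSecond (N k) N k ⟩
  s * det (N k ∷ᵛ N k ∷ᵛ removeAt N k)  ≡⟨ cong (s *_) (x≡-x⇒x≡0 (det-swap (N k) (N k) (removeAt N k))) ⟩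
  s * 0ℤ                                ≡⟨ ℤ.*-zeroʳ s ⟩
  0ℤ                                    ∎
  where
  open ≡-Reasoning
  s = -1ℤ ^ toℕ k
  x≡-x⇒x≡0 : ∀ {x} → x ≡ - x → x ≡ 0ℤ
  -- A nonzero integer and its negative are built with different constructors, so only this case
  -- survives.
  x≡-x⇒x≡0 {ℤ.+ zero} _ = refl

-- Lattice vectors and the Abelianization map.

lookup-⊕ : ∀ {d} (x y : ℤ^ d) i → lookup (x ⊕ y) i ≡ lookup x i + lookup y i
lookup-⊕ x y i = Vec.lookup-zipWith _+_ i x y

lookup-e : ∀ {d} (j i : Fin d) → lookup (e j) i ≡ (if does (i Fin.≟ j) then 1ℤ else 0ℤ)
lookup-e j = Vec.lookup∘tabulate _

⊖-⊕-cancel : ∀ {d} (x y : ℤ^ d) → x ⊖ y ⊕ y ≡ x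
⊖-⊕-cancel x y = Pointwise-≡⇒≡ (ext λ i → begin
  lookup (x ⊖ y ⊕ y) i                  ≡⟨ lookup-⊕ (x ⊖ y) y i ⟩
  lookup (x ⊖ y) i + lookup y i         ≡⟨ cong (_+ lookup y i) (Vec.lookup-zipWith _-_ i x y) ⟩
  lookup x i - lookup y i + lookup y i  ≡⟨ lemma (lookup x i) (lookup y i) ⟩
  lookup x i                            ∎)
  where
  open ≡-Reasoning
  lemma : ∀ a b → a - b + b ≡ a
  lemma = ℤ-Solver.solve-∀

lookup-f : ∀ {d} (w : List (Letter d)) i →
  lookup (f w) i ≡ foldr _+_ 0ℤ (map exponent (filter (λ a → proj₁ a Fin.≟ i) w))
lookup-f w = Vec.lookup∘tabulate _

⊕-f-[] : ∀ {d} (x : ℤ^ d) → x ⊕ f [] ≡ x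
⊕-f-[] x = Pointwise-≡⇒≡ (ext λ i → trans (lookup-⊕ x (f []) i)
  (trans (cong (lookup x i +_) (lookup-f [] i)) (ℤ.+-identityʳ (lookup x i))))

f-∷ : ∀ {d} (a : Letter d) w → f (a ∷ w) ≡ f [ a ] ⊕ f w
f-∷ {d} a w = Pointwise-≡⇒≡ (ext λ i → begin
  lookup (f (a ∷ w)) i                 ≡⟨ lookup-f (a ∷ w) i ⟩
  count (a ∷ w) i                      ≡⟨ count-∷ i ⟩
  count [ a ] i + count w i            ≡⟨ cong₂ _+_ (lookup-f [ a ] i) (lookup-f w i) ⟨
  lookup (f [ a ]) i + lookup (f w) i  ≡⟨ lookup-⊕ (f [ a ]) (f w) i ⟨
  lookup (f [ a ] ⊕ f w) i             ∎)
  where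
  open ≡-Reasoning
  count : List (Letter d) → Fin d → ℤ
  count w i = foldr _+_ 0ℤ (map exponent (filter (λ a → proj₁ a Fin.≟ i) w))

  count-∷ : ∀ i → count (a ∷ w) i ≡ count [ a ] i + count w i
  count-∷ i with does (proj₁ a Fin.≟ i)
  ... | true  = cong (_+ count w i) (sym (ℤ.+-identityʳ (exponent a)))
  ... | false = sym (ℤ.+-identityˡ (count w i))

lookup-f-letter : ∀ {d} (j : Fin d) s i →
  lookup (f [ j , s ]) i ≡ exponent (j , s) * lookup (e j) i
lookup-f-letter j s i = trans (lookup-f [ j , s ] i)
  (trans count-letter (cong (exponent (j , s) *_) (sym (lookup-e j i))))
  where
  count-letter : foldr _+_ 0ℤ (map exponent (filter (λ a → proj₁ a Fin.≟ i) [ j , s ]))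
               ≡ exponent (j , s) * (if does (i Fin.≟ j) then 1ℤ else 0ℤ)
  -- `f` decides `j ≡ i` while `e` decides `i ≡ j`; both tests are matched and the mixed outcomes
  -- refuted.
  count-letter with j Fin.≟ i | i Fin.≟ j
  ... | yes _   | yes _   = trans (ℤ.+-identityʳ (exponent (j , s))) (sym (ℤ.*-identityʳ (exponent (j , s))))
  ... | no _    | no _    = sym (ℤ.*-zeroʳ (exponent (j , s)))
  ... | yes j≡i | no i≢j  = contradiction (sym j≡i) i≢j
  ... | no j≢i  | yes i≡j = contradiction (sym i≡j) j≢i

f-positive : ∀ {d} (j : Fin d) → f [ j , Sign.+ ] ≡ e j
f-positive j = Pointwise-≡⇒≡ (ext λ i →
  trans (lookup-f-letter j Sign.+ i) (ℤ.*-identityˡ (lookup (e j) i)))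

⊕-f-negative : ∀ {d} (x : ℤ^ d) j → x ⊕ f [ j , Sign.- ] ≡ x ⊖ e j
⊕-f-negative x j = Pointwise-≡⇒≡ (ext λ i → begin
  lookup (x ⊕ f [ j , Sign.- ]) i           ≡⟨ lookup-⊕ x _ i ⟩
  lookup x i + lookup (f [ j , Sign.- ]) i  ≡⟨ cong (lookup x i +_) (lookup-f-letter j Sign.- i) ⟩
  lookup x i + -1ℤ * lookup (e j) i         ≡⟨ cong (lookup x i +_) (ℤ.-1*i≡-i (lookup (e j) i)) ⟩
  lookup x i - lookup (e j) i               ≡⟨ Vec.lookup-zipWith _-_ i x (e j) ⟨
  lookup (x ⊖ e j) i                        ∎)
  where open ≡-Reasoning

-- Telescoping of the dual map along words.

-- `χ` is a potential for `E`. The sign is that of a decrease, so that the indicator of a lower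
-- half-space gives a function with values 0 and 1 when the normal vector is non-negative.
Gradient : ∀ {d} → SteppedFunction d → (ℤ^ d → ℤ) → Set
Gradient E χ = ∀ y j → E y j ≡ χ y - χ (y ⊕ e j)

-- An inverse letter traverses the edge from `y ⊖ e j` to `y` backwards. The shift by `e j` and the
-- minus sign in the dual map together account for this, so both kinds of letters obey one formula.
letter-gradient : ∀ {d} {E : SteppedFunction d} {χ} → Gradient E χ → ∀ a y →
  positiveTerm E a y - negativeTerm E a y ≡ χ y - χ (y ⊕ f [ a ])
letter-gradient {E = E} {χ} grad (j , Sign.+) y = begin
  E y j - 0ℤ                      ≡⟨ ℤ.+-identityʳ (E y j) ⟩
  E y j                           ≡⟨ grad y j ⟩
  χ y - χ (y ⊕ e j)               ≡⟨ cong (λ v → χ y - χ (y ⊕ v)) (f-positive j) ⟨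
  χ y - χ (y ⊕ f [ j , Sign.+ ])  ∎
  where open ≡-Reasoning
letter-gradient {E = E} {χ} grad (j , Sign.-) y = begin
  0ℤ - E (y ⊖ e j) j                      ≡⟨ cong (λ t → 0ℤ - t) (grad (y ⊖ e j) j) ⟩
  0ℤ - (χ (y ⊖ e j) - χ (y ⊖ e j ⊕ e j))  ≡⟨ lemma (χ (y ⊖ e j)) (χ (y ⊖ e j ⊕ e j)) ⟩
  χ (y ⊖ e j ⊕ e j) - χ (y ⊖ e j)         ≡⟨ cong₂ (λ u v → χ u - χ v) (⊖-⊕-cancel y (e j)) (sym (⊕-f-negative y j)) ⟩
  χ y - χ (y ⊕ f [ j , Sign.- ])          ∎
  where
  open ≡-Reasoning
  lemma : ∀ a b → 0ℤ - (a - b) ≡ b - a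
  lemma = ℤ-Solver.solve-∀

-- The prefixes of `w` trace a lattice path from `z` to `z ⊕ f w`, and each occurrence contributes
-- the drop of `χ` along its step. The starting point is arbitrary so that the induction can move it
-- past the first letter.
word-gradient : ∀ {d} {E : SteppedFunction d} {χ} → Gradient E χ → ∀ w z →
  sumℤ {length w} (λ k → positiveTerm E (List.lookup w k) (z ⊕ f (take (toℕ k) w))) -
  sumℤ {length w} (λ k → negativeTerm E (List.lookup w k) (z ⊕ f (take (toℕ k) w)))
  ≡ χ z - χ (z ⊕ f w)
word-gradient {χ = χ} grad [] z =
  sym (ℤ.i≡j⇒i-j≡0 (cong χ (sym (⊕-f-[] z))))
word-gradient {d} {E} {χ} grad (a ∷ w) z = begin
  positiveTerm E a (z ⊕ f []) + pos (λ k → z ⊕ f (a ∷ take (toℕ k) w)) -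
  (negativeTerm E a (z ⊕ f []) + neg (λ k → z ⊕ f (a ∷ take (toℕ k) w)))
    ≡⟨ regroup (positiveTerm E a (z ⊕ f [])) (pos (λ k → z ⊕ f (a ∷ take (toℕ k) w)))
               (negativeTerm E a (z ⊕ f [])) (neg (λ k → z ⊕ f (a ∷ take (toℕ k) w))) ⟩
  positiveTerm E a (z ⊕ f []) - negativeTerm E a (z ⊕ f []) +
  (pos (λ k → z ⊕ f (a ∷ take (toℕ k) w)) - neg (λ k → z ⊕ f (a ∷ take (toℕ k) w)))
    ≡⟨ cong₂ _+_
         (cong (λ y → positiveTerm E a y - negativeTerm E a y) (⊕-f-[] z))
         (cong₂ _-_
           (Σℤ.sum-cong-≗ {length w} λ k → cong (positiveTerm E (List.lookup w k)) (shift (take (toℕ k) w)))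
           (Σℤ.sum-cong-≗ {length w} λ k → cong (negativeTerm E (List.lookup w k)) (shift (take (toℕ k) w)))) ⟩
  positiveTerm E a z - negativeTerm E a z +
  (pos (λ k → z′ ⊕ f (take (toℕ k) w)) - neg (λ k → z′ ⊕ f (take (toℕ k) w)))
    ≡⟨ cong₂ _+_ (letter-gradient {χ = χ} grad a z) (word-gradient {χ = χ} grad w z′) ⟩
  χ z - χ z′ + (χ z′ - χ (z′ ⊕ f w))
    ≡⟨ telescope (χ z) (χ z′) (χ (z′ ⊕ f w)) ⟩
  χ z - χ (z′ ⊕ f w)
    ≡⟨ cong (λ y → χ z - χ y) (shift w) ⟨
  χ z - χ (z ⊕ f (a ∷ w)) ∎
  where
  open ≡-Reasoning
  z′ = z ⊕ f [ a ]

  pos neg : (Fin (length w) → ℤ^ d) → ℤ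
  pos y = sumℤ (λ k → positiveTerm E (List.lookup w k) (y k))
  neg y = sumℤ (λ k → negativeTerm E (List.lookup w k) (y k))

  shift : ∀ v → z ⊕ f (a ∷ v) ≡ z′ ⊕ f v
  shift v = trans (cong (z ⊕_) (f-∷ a v))
    (sym (Vec.zipWith-assoc ℤ.+-assoc z (f [ a ]) (f v)))

  regroup : ∀ p P n N → p + P - (n + N) ≡ p - n + (P - N)
  regroup = ℤ-Solver.solve-∀
  telescope : ∀ a b c → a - b + (b - c) ≡ a - c
  telescope = ℤ-Solver.solve-∀

E₁*-gradient : ∀ {d} (σ : Morphism d) {E : SteppedFunction d} {χ} → Gradient E χ → ∀ x i →
  E₁* σ E x i ≡ χ (incidence σ · x) - χ (incidence σ · x ⊕ f (image σ i))
E₁*-gradient σ {χ = χ} grad x i = word-gradient {χ = χ} grad (image σ i) (incidence σ · x)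

module RealLemmas (ℝ : Reals) where
  open Reals ℝ
  open SteppedPlanes ℝ

  private
    module R = CommutativeRing commutativeRing
    module Rₚ = RingProperties R.ring
    module Rₘ = SemiringMult R.semiring
    module Σᴿ = SemiringSum R.semiring
    module ≤ = IsDecTotalOrder isDecTotalOrder
    module < = ToStrict _≈_ _≤_
  open SetoidReasoning R.setoid

  -- The ring homomorphism from the integers to the reals.

  fromℤ-neg : ∀ z → fromℤ (- z) ≈ -ᴿ fromℤ z
  fromℤ-neg (ℤ.+ zero)  = R.sym Rₚ.-0#≈0#
  fromℤ-neg (ℤ.+ suc n) = R.refl
  fromℤ-neg -[1+ n ]    = R.sym (Rₚ.-‿involutive _)

  -- Integer addition with mixed signs computes through `ℤ._⊖_`; cancelling one unit at a time
  -- settles this case of additivity.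
  fromℤ-⊖ : ∀ m n → fromℤ (m ℤ.⊖ n) ≈ (m ×ᴿ 1ᴿ) +ᴿ -ᴿ (n ×ᴿ 1ᴿ)
  fromℤ-⊖ zero    zero    = R.sym (R.-‿inverseʳ 0ᴿ)
  fromℤ-⊖ zero    (suc n) = R.sym (R.+-identityˡ _)
  fromℤ-⊖ (suc m) zero    = R.sym (R.trans (R.+-congˡ Rₚ.-0#≈0#) (R.+-identityʳ _))
  fromℤ-⊖ (suc m) (suc n) = begin
    fromℤ (suc m ℤ.⊖ suc n)     ≡⟨ cong fromℤ (ℤ.[1+m]⊖[1+n]≡m⊖n m n) ⟩
    fromℤ (m ℤ.⊖ n)             ≈⟨ fromℤ-⊖ m n ⟩
    a +ᴿ -ᴿ b                   ≈⟨ R.+-congʳ (Rₚ.xyx⁻¹≈y 1ᴿ a) ⟨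
    1ᴿ +ᴿ a +ᴿ -ᴿ 1ᴿ +ᴿ -ᴿ b    ≈⟨ R.+-assoc _ _ _ ⟩
    1ᴿ +ᴿ a +ᴿ (-ᴿ 1ᴿ +ᴿ -ᴿ b)  ≈⟨ R.+-congˡ (Rₚ.-‿+-comm 1ᴿ b) ⟩
    1ᴿ +ᴿ a +ᴿ -ᴿ (1ᴿ +ᴿ b)     ∎
    where
    a = m ×ᴿ 1ᴿ
    b = n ×ᴿ 1ᴿ

  fromℤ-+ : ∀ y z → fromℤ (y + z) ≈ fromℤ y +ᴿ fromℤ z
  fromℤ-+ (ℤ.+ m)  (ℤ.+ n)  = Rₘ.×-homo-+ 1ᴿ m n
  fromℤ-+ (ℤ.+ m)  -[1+ n ] = fromℤ-⊖ m (suc n)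
  fromℤ-+ -[1+ m ] (ℤ.+ n)  = R.trans (fromℤ-⊖ n (suc m)) (R.+-comm _ _)
  fromℤ-+ -[1+ m ] -[1+ n ] = begin
    -ᴿ (suc (suc (m ℕ.+ n)) ×ᴿ 1ᴿ)        ≡⟨ cong (λ k → -ᴿ (suc k ×ᴿ 1ᴿ)) (ℕ.+-suc m n) ⟨
    -ᴿ ((suc m ℕ.+ suc n) ×ᴿ 1ᴿ)          ≈⟨ R.-‿cong (Rₘ.×-homo-+ 1ᴿ (suc m) (suc n)) ⟩
    -ᴿ ((suc m ×ᴿ 1ᴿ) +ᴿ (suc n ×ᴿ 1ᴿ))   ≈⟨ Rₚ.-‿+-comm _ _ ⟨
    -ᴿ (suc m ×ᴿ 1ᴿ) +ᴿ -ᴿ (suc n ×ᴿ 1ᴿ)  ∎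

  fromℤ-+* : ∀ n z → fromℤ (ℤ.+ n * z) ≈ (n ×ᴿ 1ᴿ) *ᴿ fromℤ z
  fromℤ-+* zero    z = R.trans (R.reflexive (cong fromℤ (ℤ.*-zeroˡ z))) (R.sym (R.zeroˡ _))
  fromℤ-+* (suc n) z = begin
    fromℤ (ℤ.+ suc n * z)                  ≡⟨ cong fromℤ (ℤ.suc-* (ℤ.+ n) z) ⟩
    fromℤ (z + (ℤ.+ n * z))                ≈⟨ fromℤ-+ z (ℤ.+ n * z) ⟩
    fromℤ z +ᴿ fromℤ (ℤ.+ n * z)           ≈⟨ R.+-cong (R.sym (R.*-identityˡ _)) (fromℤ-+* n z) ⟩
    1ᴿ *ᴿ fromℤ z +ᴿ (n ×ᴿ 1ᴿ) *ᴿ fromℤ z  ≈⟨ R.distribʳ _ _ _ ⟨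
    (1ᴿ +ᴿ (n ×ᴿ 1ᴿ)) *ᴿ fromℤ z           ∎

  fromℤ-* : ∀ y z → fromℤ (y * z) ≈ fromℤ y *ᴿ fromℤ z
  fromℤ-* (ℤ.+ n)  z = fromℤ-+* n z
  fromℤ-* -[1+ n ] z = begin
    fromℤ (-[1+ n ] * z)               ≡⟨ cong fromℤ (ℤ.neg-distribˡ-* (ℤ.+ suc n) z) ⟨
    fromℤ (- (ℤ.+ suc n * z))          ≈⟨ fromℤ-neg (ℤ.+ suc n * z) ⟩
    -ᴿ fromℤ (ℤ.+ suc n * z)           ≈⟨ R.-‿cong (fromℤ-+* (suc n) z) ⟩
    -ᴿ (fromℤ (ℤ.+ suc n) *ᴿ fromℤ z)  ≈⟨ Rₚ.-‿distribˡ-* _ _ ⟩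
    -ᴿ fromℤ (ℤ.+ suc n) *ᴿ fromℤ z    ∎

  fromℤ-sum : ∀ {n} (t : Vector ℤ n) → fromℤ (sumℤ t) ≈ sum (fromℤ ∘ t)
  fromℤ-sum {zero}  t = R.refl
  fromℤ-sum {suc n} t = R.trans (fromℤ-+ (t zero) _) (R.+-congˡ (fromℤ-sum (t ∘ suc)))

  -- Scalar products, transposed matrices and injectivity.

  sum-≈0 : ∀ {n} (t : Vector Carrier n) → (∀ i → t i ≈ 0ᴿ) → sum t ≈ 0ᴿ
  sum-≈0 {n} t t≈0 = R.trans (Σᴿ.sum-cong-≋ {n} t≈0) (Σᴿ.sum-replicate-zero n)

  ⟨⊕∣⟩ : ∀ {d} (x y : ℤ^ d) α → ⟨ x ⊕ y ∣ α ⟩ ≈ ⟨ x ∣ α ⟩ +ᴿ ⟨ y ∣ α ⟩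
  ⟨⊕∣⟩ {d} x y α = begin
    sum (λ i → fromℤ (lookup (x ⊕ y) i) *ᴿ α i)
      ≈⟨ Σᴿ.sum-cong-≋ {d} (λ i → R.trans
           (R.*-congʳ (R.trans (R.reflexive (cong fromℤ (lookup-⊕ x y i))) (fromℤ-+ (lookup x i) (lookup y i))))
           (R.distribʳ (α i) _ _)) ⟩
    sum (λ i → fromℤ (lookup x i) *ᴿ α i +ᴿ fromℤ (lookup y i) *ᴿ α i)
      ≈⟨ Σᴿ.∑-distrib-+ {d} _ _ ⟩
    ⟨ x ∣ α ⟩ +ᴿ ⟨ y ∣ α ⟩ ∎

  ⟨e∣⟩ : ∀ {d} (i : Fin d) α → ⟨ e i ∣ α ⟩ ≈ α i
  ⟨e∣⟩ {d} i α = R.trans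
    (Σᴿ.sum-cong-≋ {d} λ k → R.*-congʳ (R.reflexive (cong fromℤ (lookup-e i k))))
    (sum-δ i α)
    where
    -- Phrased with the decision instead of `e i`: `does (suc k Fin.≟ suc i)` computes to
    -- `does (k Fin.≟ i)`, so the induction passes to the tail.
    sum-δ : ∀ {d} (i : Fin d) (α : ℝ^ d) →
            sum (λ k → fromℤ (if does (k Fin.≟ i) then 1ℤ else 0ℤ) *ᴿ α k) ≈ α i
    sum-δ {suc d} zero α = begin
      (1ᴿ +ᴿ 0ᴿ) *ᴿ α zero +ᴿ sum (λ k → 0ᴿ *ᴿ α (suc k))
        ≈⟨ R.+-cong (R.*-congʳ (R.+-identityʳ 1ᴿ)) (sum-≈0 _ (λ k → R.zeroˡ (α (suc k)))) ⟩
      1ᴿ *ᴿ α zero +ᴿ 0ᴿ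
        ≈⟨ R.trans (R.+-identityʳ _) (R.*-identityˡ _) ⟩
      α zero ∎
    sum-δ {suc d} (suc i) α = begin
      0ᴿ *ᴿ α zero +ᴿ sum (λ k → fromℤ (if does (k Fin.≟ i) then 1ℤ else 0ℤ) *ᴿ α (suc k))
        ≈⟨ R.+-cong (R.zeroˡ _) (sum-δ i (α ∘ suc)) ⟩
      0ᴿ +ᴿ α (suc i)
        ≈⟨ R.+-identityˡ _ ⟩
      α (suc i) ∎

  ⟨⊕e∣⟩ : ∀ {d} (x : ℤ^ d) i α → ⟨ x ⊕ e i ∣ α ⟩ ≈ ⟨ x ∣ α ⟩ +ᴿ α i
  ⟨⊕e∣⟩ x i α = R.trans (⟨⊕∣⟩ x (e i) α) (R.+-congˡ (⟨e∣⟩ i α))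

  -- Adjointness, by reading a double sum in the other order. It turns heights over `α` at `M · x`
  -- into heights over the transposed image of `α` at `x`.
  ⟨·∣⟩ : ∀ {d} (M : Matrix d) (x : ℤ^ d) α → ⟨ M · x ∣ α ⟩ ≈ ⟨ x ∣ M ᵀ· α ⟩
  ⟨·∣⟩ {d} M x α = begin
    sum (λ i → fromℤ (lookup (M · x) i) *ᴿ α i)
      ≈⟨ Σᴿ.sum-cong-≋ {d} (λ i → R.*-congʳ (R.trans
           (R.reflexive (cong fromℤ (Vec.lookup∘tabulate _ i)))
           (fromℤ-sum (λ j → M i j * lookup x j)))) ⟩
    sum (λ i → sum (λ j → fromℤ (M i j * lookup x j)) *ᴿ α i)
      ≈⟨ Σᴿ.sum-cong-≋ {d} (λ i → Σᴿ.*-distribʳ-sum {d} (α i) _) ⟩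
    sum (λ i → sum (λ j → fromℤ (M i j * lookup x j) *ᴿ α i))
      ≈⟨ Σᴿ.∑-comm {d} {d} _ ⟩
    sum (λ j → sum (λ i → fromℤ (M i j * lookup x j) *ᴿ α i))
      ≈⟨ Σᴿ.sum-cong-≋ {d} (λ j → Σᴿ.sum-cong-≋ {d} (λ i → R.trans
           (R.*-congʳ (R.trans (fromℤ-* (M i j) (lookup x j)) (R.*-comm _ _)))
           (R.*-assoc _ _ _))) ⟩
    sum (λ j → sum (λ i → fromℤ (lookup x j) *ᴿ (fromℤ (M i j) *ᴿ α i)))
      ≈⟨ Σᴿ.sum-cong-≋ {d} (λ j → Σᴿ.*-distribˡ-sum {d} (fromℤ (lookup x j)) _) ⟨
    ⟨ x ∣ M ᵀ· α ⟩ ∎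

  -- Cramer's rule: v ↦ det (v ∷ᵛ removeAt M k) is a linear form that vanishes on
  -- every row of M but the k-th, on which it is ± det M.
  ᵀ·-kernel : ∀ {d} (M : Matrix d) α → (∀ j → (M ᵀ· α) j ≈ 0ᴿ) → ∀ k → fromℤ (det M) *ᴿ α k ≈ 0ᴿ
  ᵀ·-kernel {suc n} M α Mᵀα≈0 k = begin
    fromℤ (det M) *ᴿ α k
      ≡⟨ cong (λ z → fromℤ z *ᴿ α k) (det-moveToFront M k) ⟩
    fromℤ (-1ℤ ^ toℕ k * D (M k)) *ᴿ α k
      ≈⟨ R.trans (R.*-congʳ (fromℤ-* (-1ℤ ^ toℕ k) (D (M k)))) (R.*-assoc _ _ _) ⟩
    fromℤ (-1ℤ ^ toℕ k) *ᴿ (fromℤ (D (M k)) *ᴿ α k)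
      ≈⟨ R.*-congˡ D-row≈0 ⟩
    fromℤ (-1ℤ ^ toℕ k) *ᴿ 0ᴿ
      ≈⟨ R.zeroʳ _ ⟩
    0ᴿ ∎
    where
    D : Vector ℤ (suc n) → ℤ
    D v = det (v ∷ᵛ removeAt M k)

    c : Fin (suc n) → ℤ
    c j = det (deleteColumn j (removeAt M k))

    regroup : ∀ s v m a → fromℤ (s * v * m) *ᴿ a ≈ fromℤ (s * m) *ᴿ (fromℤ v *ᴿ a)
    regroup s v m a = begin
      fromℤ (s * v * m) *ᴿ a           ≡⟨ cong (λ z → fromℤ z *ᴿ a) (swap s v m) ⟩
      fromℤ (s * m * v) *ᴿ a           ≈⟨ R.*-congʳ (fromℤ-* (s * m) v) ⟩
      fromℤ (s * m) *ᴿ fromℤ v *ᴿ a    ≈⟨ R.*-assoc _ _ _ ⟩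
      fromℤ (s * m) *ᴿ (fromℤ v *ᴿ a)  ∎
      where
      swap : ∀ s v m → s * v * m ≡ s * m * v
      swap s v m = trans (ℤ.*-assoc s v m)
        (trans (cong (s *_) (ℤ.*-comm v m)) (sym (ℤ.*-assoc s m v)))

    -- `D` is linear with the signed minors `c` as coefficients. Exchanging the sums therefore pairs
    -- these coefficients with the entries of `M ᵀ· α`, all of which vanish.
    D-combination≈0 : sum (λ i → fromℤ (D (M i)) *ᴿ α i) ≈ 0ᴿ
    D-combination≈0 = begin
      sum (λ i → fromℤ (D (M i)) *ᴿ α i)
        ≈⟨ Σᴿ.sum-cong-≋ {suc n} (λ i → R.trans
             (R.*-congʳ (fromℤ-sum (λ j → -1ℤ ^ toℕ j * M i j * c j)))
             (Σᴿ.*-distribʳ-sum {suc n} (α i) (λ j → fromℤ (-1ℤ ^ toℕ j * M i j * c j)))) ⟩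
      sum (λ i → sum (λ j → fromℤ (-1ℤ ^ toℕ j * M i j * c j) *ᴿ α i))
        ≈⟨ Σᴿ.∑-comm {suc n} {suc n} (λ i j → fromℤ (-1ℤ ^ toℕ j * M i j * c j) *ᴿ α i) ⟩
      sum (λ j → sum (λ i → fromℤ (-1ℤ ^ toℕ j * M i j * c j) *ᴿ α i))
        ≈⟨ Σᴿ.sum-cong-≋ {suc n} (λ j → R.trans
             (Σᴿ.sum-cong-≋ {suc n} (λ i → regroup (-1ℤ ^ toℕ j) (M i j) (c j) (α i)))
             (R.sym (Σᴿ.*-distribˡ-sum {suc n} (fromℤ (-1ℤ ^ toℕ j * c j)) (λ i → fromℤ (M i j) *ᴿ α i)))) ⟩
      sum (λ j → fromℤ (-1ℤ ^ toℕ j * c j) *ᴿ (M ᵀ· α) j)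
        ≈⟨ sum-≈0 _ (λ j → R.trans (R.*-congˡ {fromℤ (-1ℤ ^ toℕ j * c j)} (Mᵀα≈0 j)) (R.zeroʳ _)) ⟩
      0ᴿ ∎

    D-row≈0 : fromℤ (D (M k)) *ᴿ α k ≈ 0ᴿ
    D-row≈0 = begin
      fromℤ (D (M k)) *ᴿ α k
        ≈⟨ R.+-identityʳ _ ⟨
      fromℤ (D (M k)) *ᴿ α k +ᴿ 0ᴿ
        ≈⟨ R.+-congˡ (sum-≈0 _ (λ r → R.trans
             (R.*-congʳ (R.reflexive (cong fromℤ (det-repeatedRow (removeAt M k) r))))
             (R.zeroˡ _))) ⟨
      fromℤ (D (M k)) *ᴿ α k +ᴿ sum (λ r → fromℤ (D (M (punchIn k r))) *ᴿ α (punchIn k r))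
        ≈⟨ Σᴿ.sum-remove {n} {k} (λ i → fromℤ (D (M i)) *ᴿ α i) ⟨
      sum (λ i → fromℤ (D (M i)) *ᴿ α i)
        ≈⟨ D-combination≈0 ⟩
      0ᴿ ∎

  ᵀ·-injective : ∀ {d} (M : Matrix d) → det M ≡ 1ℤ ⊎ det M ≡ -1ℤ → ∀ α →
                 (∀ j → (M ᵀ· α) j ≈ 0ᴿ) → ∀ k → α k ≈ 0ᴿ
  ᵀ·-injective M (inj₁ det≡1) α Mᵀα≈0 k = begin
    α k                   ≈⟨ R.*-identityˡ _ ⟨
    1ᴿ *ᴿ α k             ≈⟨ R.*-congʳ (R.+-identityʳ 1ᴿ) ⟨
    fromℤ 1ℤ *ᴿ α k       ≡⟨ cong (λ z → fromℤ z *ᴿ α k) det≡1 ⟨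
    fromℤ (det M) *ᴿ α k  ≈⟨ ᵀ·-kernel M α Mᵀα≈0 k ⟩
    0ᴿ                    ∎
  ᵀ·-injective M (inj₂ det≡-1) α Mᵀα≈0 k = begin
    α k                        ≈⟨ Rₚ.-‿involutive _ ⟨
    -ᴿ (-ᴿ α k)                ≈⟨ R.-‿cong (Rₚ.-1*x≈-x _) ⟨
    -ᴿ (-ᴿ 1ᴿ *ᴿ α k)          ≈⟨ R.-‿cong (R.*-congʳ (R.-‿cong (R.+-identityʳ 1ᴿ))) ⟨
    -ᴿ (fromℤ -1ℤ *ᴿ α k)      ≡⟨ cong (λ z → -ᴿ (fromℤ z *ᴿ α k)) det≡-1 ⟨
    -ᴿ (fromℤ (det M) *ᴿ α k)  ≈⟨ R.-‿cong (ᵀ·-kernel M α Mᵀα≈0 k) ⟩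
    -ᴿ 0ᴿ                      ≈⟨ Rₚ.-0#≈0# ⟩
    0ᴿ                         ∎

  -- Order on the reals and the archimedean property.

  ≤-resp : ∀ {x x′ y y′} → x ≈ x′ → y ≈ y′ → x ≤ y → x′ ≤ y′
  ≤-resp x≈ y≈ x≤y = ≤.trans (≤.reflexive (R.sym x≈)) (≤.trans x≤y (≤.reflexive y≈))

  +-cancelʳ-≤ : ∀ {x y} z → x +ᴿ z ≤ y +ᴿ z → x ≤ y
  +-cancelʳ-≤ {x} {y} z x+z≤y+z =
    ≤-resp (Rₚ.//-rightDividesʳ z x) (Rₚ.//-rightDividesʳ z y) (+-monoˡ-≤ (-ᴿ z) x+z≤y+z)

  x≤x+y : ∀ x {y} → 0ᴿ ≤ y → x ≤ x +ᴿ y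
  x≤x+y x {y} 0≤y = ≤-resp (R.+-identityˡ x) (R.+-comm y x) (+-monoˡ-≤ x 0≤y)

  neg-antimono-≤ : ∀ {x y} → x ≤ y → -ᴿ y ≤ -ᴿ x
  neg-antimono-≤ {x} {y} x≤y = ≤-resp
    (R.trans (R.sym (R.+-assoc x (-ᴿ x) (-ᴿ y))) (R.trans (R.+-congʳ (R.-‿inverseʳ x)) (R.+-identityˡ _)))
    (R.trans (R.sym (R.+-assoc y (-ᴿ x) (-ᴿ y))) (Rₚ.xyx⁻¹≈y y (-ᴿ x)))
    (+-monoˡ-≤ (-ᴿ x +ᴿ -ᴿ y) x≤y)

  ≰⇒> : ∀ {x y} → ¬ (x ≤ y) → y < x
  ≰⇒> = <.≰⇒> R.sym ≤.reflexive ≤.total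

  ≮⇒≥ : ∀ {x y} → ¬ (x < y) → y ≤ x
  ≮⇒≥ {x} {y} x≮y = decidable-stable (y ≤? x) (x≮y ∘ ≰⇒>)

  <⇒≱ : ∀ {x y} → x < y → ¬ (y ≤ x)
  <⇒≱ = <.<⇒≱ ≤.antisym

  -- The least upper bound u of the progression would give the upper bound u − c.
  progression-unbounded : ∀ (s : ℕ → Carrier) c b → ¬ (c ≤ 0ᴿ) →
    (∀ n → s (suc n) ≈ s n +ᴿ c) → ¬ (∀ n → s n ≤ b)
  progression-unbounded s c b c≰0 s-suc s≤b
    with supremum (λ x → ∃ λ n → x ≈ s n) (s 0 , 0 , R.refl)
           (b , λ { x (n , x≈sn) → ≤-resp (R.sym x≈sn) R.refl (s≤b n) })
  ... | u , upper , least = c≰0 (+-cancelʳ-≤ u (≤-resp (R.+-comm u c) (R.sym (R.+-identityˡ u)) u+c≤u))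
    where
    u-c-upper : ∀ x → (∃ λ n → x ≈ s n) → x ≤ u +ᴿ -ᴿ c
    u-c-upper x (n , x≈sn) = +-cancelʳ-≤ c (≤-resp
      (R.trans (s-suc n) (R.+-congʳ (R.sym x≈sn)))
      (R.sym (Rₚ.//-rightDividesˡ c u))
      (upper (s (suc n)) (suc n , R.refl)))

    u+c≤u : u +ᴿ c ≤ u
    u+c≤u = ≤-resp R.refl (Rₚ.//-rightDividesˡ c u) (+-monoˡ-≤ c (least (u +ᴿ -ᴿ c) u-c-upper))

  -- Half-line indicators and stepped planes as gradients.

  belowIndicator : Carrier → Carrier → ℤ
  belowIndicator ρ t = if does (t <? ρ) then 1ℤ else 0ℤ

  below-1 : ∀ {ρ t} → t < ρ → belowIndicator ρ t ≡ 1ℤ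
  below-1 {ρ} {t} t<ρ = cong (if_then 1ℤ else 0ℤ) (dec-true (t <? ρ) t<ρ)

  below-0 : ∀ {ρ t} → ρ ≤ t → belowIndicator ρ t ≡ 0ℤ
  below-0 {ρ} {t} ρ≤t =
    cong (if_then 1ℤ else 0ℤ) (dec-false (t <? ρ) (λ t<ρ → <⇒≱ t<ρ ρ≤t))

  below-cong : ∀ ρ {t t′} → t ≈ t′ → belowIndicator ρ t ≡ belowIndicator ρ t′
  below-cong ρ {t} {t′} t≈t′ = case (t <? ρ)
    where
    case : Dec (t < ρ) → belowIndicator ρ t ≡ belowIndicator ρ t′
    case (yes t<ρ) = trans (below-1 t<ρ)
      (sym (below-1 (≰⇒> λ ρ≤t′ → <⇒≱ t<ρ (≤-resp R.refl (R.sym t≈t′) ρ≤t′))))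
    case (no t≮ρ)  = trans (below-0 (≮⇒≥ t≮ρ)) (sym (below-0 (≤-resp R.refl t≈t′ (≮⇒≥ t≮ρ))))

  -- The assumption `t ≤ t′` rules out `t′ < ρ ≤ t`, the one configuration in which the difference
  -- would be -1.
  interval-indicator : ∀ ρ {t t′} → t ≤ t′ →
    (if does ((t <? ρ) ×-dec (ρ ≤? t′)) then 1ℤ else 0ℤ) ≡ belowIndicator ρ t - belowIndicator ρ t′
  interval-indicator ρ {t} {t′} t≤t′ = case (t <? ρ) (ρ ≤? t′)
    where
    case : (p : Dec (t < ρ)) (q : Dec (ρ ≤ t′)) →
      (if does (p ×-dec q) then 1ℤ else 0ℤ) ≡ belowIndicator ρ t - belowIndicator ρ t′
    case (yes t<ρ) (yes ρ≤t′) = sym (cong₂ _-_ (below-1 t<ρ) (below-0 ρ≤t′))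
    case (yes t<ρ) (no ρ≰t′)  = sym (cong₂ _-_ (below-1 t<ρ) (below-1 (≰⇒> ρ≰t′)))
    case (no t≮ρ)  _          =
      sym (cong₂ _-_ (below-0 (≮⇒≥ t≮ρ)) (below-0 (≤.trans (≮⇒≥ t≮ρ) t≤t′)))

  -- As `α j` is non-negative, a step along `e j` never lowers the scalar product, so `ρ` can only
  -- be crossed upwards.
  steppedPlane-gradient : ∀ {d} (α : ℝ^ d) α-normal ρ →
    Gradient (steppedPlane α α-normal ρ) (λ y → belowIndicator ρ ⟨ y ∣ α ⟩)
  steppedPlane-gradient α α-normal ρ y j = interval-indicator ρ
    (≤-resp R.refl (R.sym (⟨⊕e∣⟩ y j α)) (x≤x+y ⟨ y ∣ α ⟩ (proj₁ α-normal j)))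

  -- The dual image of a stepped plane.

  module _ {d} (σ : Morphism d) (α : ℝ^ d) (α-normal : IsNormal α) (ρ : Carrier) where

    private
      P : SteppedFunction d
      P = steppedPlane α α-normal ρ

      β : ℝ^ d
      β = incidence σ ᵀ· α

    -- The entries of `β` may have any sign here; all three assertions are compared through this
    -- formula, whose value is -1 exactly where a step along `e i` crosses `ρ` downwards.
    dual-steppedPlane : ∀ x i →
      E₁* σ P x i ≡ belowIndicator ρ ⟨ x ∣ β ⟩ - belowIndicator ρ ⟨ x ⊕ e i ∣ β ⟩
    dual-steppedPlane x i = trans
      (E₁*-gradient σ {χ = λ y → belowIndicator ρ ⟨ y ∣ α ⟩} (steppedPlane-gradient α α-normal ρ) x i)
      (cong₂ _-_
        (below-cong ρ (⟨·∣⟩ (incidence σ) x α))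
        -- The vector `f (image σ i)` is the i-th column of the incidence matrix, so its scalar
        -- product with `α` is `β i` by definition.
        (below-cong ρ (R.trans (⟨⊕∣⟩ (incidence σ · x) (f (image σ i)) α)
          (R.trans (R.+-congʳ (⟨·∣⟩ (incidence σ) x α)) (R.sym (⟨⊕e∣⟩ x i β))))))

    -- A downward crossing of `ρ` along `e i` would produce the value 0 - 1.
    binary-step : Binary (E₁* σ P) → ∀ x i → ρ ≤ ⟨ x ∣ β ⟩ → ρ ≤ ⟨ x ⊕ e i ∣ β ⟩
    binary-step binary x i ρ≤x = decidable-stable (ρ ≤? ⟨ x ⊕ e i ∣ β ⟩) λ ρ≰x+e →
      notBinary (trans (dual-steppedPlane x i)
        (cong₂ _-_ (below-0 ρ≤x) (below-1 (≰⇒> ρ≰x+e)))) (binary x i)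
      where
      notBinary : ∀ {z} → z ≡ -1ℤ → ¬ (z ≡ 0ℤ ⊎ z ≡ 1ℤ)
      notBinary refl (inj₁ ())
      notBinary refl (inj₂ ())

    -- If β i < 0, then ⟨ n e_i ∣ β ⟩ tends to ∓∞ for n → ±∞, so that it crosses ρ
    -- downwards somewhere on the line ℤ e_i, where the dual map takes the value -1.
    binary⇒nonNegative : Binary (E₁* σ P) → NonNegative β
    binary⇒nonNegative binary i = decidable-stable (0ᴿ ≤? β i) λ 0≰βᵢ →
      noCrossing (0≰βᵢ ∘ nonNegative) (ρ ≤? ⟨ origin ∣ β ⟩)
      where
      origin : ℤ^ d
      origin = replicate d 0ℤ

      forward backward : ℕ → ℤ^ d
      forward zero     = origin
      forward (suc n)  = forward n ⊕ e i
      backward zero    = origin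
      backward (suc n) = backward n ⊖ e i

      backward-step : ∀ n → ⟨ backward (suc n) ∣ β ⟩ ≈ ⟨ backward n ∣ β ⟩ +ᴿ -ᴿ β i
      backward-step n = begin
        ⟨ backward (suc n) ∣ β ⟩                   ≈⟨ Rₚ.//-rightDividesʳ (β i) _ ⟨
        ⟨ backward (suc n) ∣ β ⟩ +ᴿ β i +ᴿ -ᴿ β i  ≈⟨ R.+-congʳ (⟨⊕e∣⟩ (backward (suc n)) i β) ⟨
        ⟨ backward (suc n) ⊕ e i ∣ β ⟩ +ᴿ -ᴿ β i   ≡⟨ cong (λ y → ⟨ y ∣ β ⟩ +ᴿ -ᴿ β i) (⊖-⊕-cancel (backward n) (e i)) ⟩
        ⟨ backward n ∣ β ⟩ +ᴿ -ᴿ β i               ∎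

      forward-above : ρ ≤ ⟨ origin ∣ β ⟩ → ∀ n → ρ ≤ ⟨ forward n ∣ β ⟩
      forward-above ρ≤origin zero    = ρ≤origin
      forward-above ρ≤origin (suc n) = binary-step binary (forward n) i (forward-above ρ≤origin n)

      -- The contrapositive of `binary-step`: adding `e i` to `backward (suc n)` leads back to
      -- `backward n`.
      backward-below : ¬ (ρ ≤ ⟨ origin ∣ β ⟩) → ∀ n → ¬ (ρ ≤ ⟨ backward n ∣ β ⟩)
      backward-below ρ≰origin zero    = ρ≰origin
      backward-below ρ≰origin (suc n) ρ≤ = backward-below ρ≰origin n
        (subst (λ y → ρ ≤ ⟨ y ∣ β ⟩) (⊖-⊕-cancel (backward n) (e i))
          (binary-step binary (backward (suc n)) i ρ≤))

      nonNegative : -ᴿ β i ≤ 0ᴿ → 0ᴿ ≤ β i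
      nonNegative = ≤-resp Rₚ.-0#≈0# (Rₚ.-‿involutive (β i)) ∘ neg-antimono-≤

      noCrossing : ¬ (-ᴿ β i ≤ 0ᴿ) → Dec (ρ ≤ ⟨ origin ∣ β ⟩) → ⊥
      -- From a start at or above `ρ`, the forward walk stays there although each step adds `β i`;
      -- negating the heights gives an increasing progression bounded by `-ᴿ ρ`.
      noCrossing -βᵢ≰0 (yes ρ≤origin) =
        progression-unbounded (λ n → -ᴿ ⟨ forward n ∣ β ⟩) (-ᴿ β i) (-ᴿ ρ) -βᵢ≰0
          (λ n → R.trans (R.-‿cong (⟨⊕e∣⟩ (forward n) i β)) (R.sym (Rₚ.-‿+-comm _ _)))
          (λ n → neg-antimono-≤ (forward-above ρ≤origin n))
      -- From a start below `ρ`, the backward walk stays below although each step raises the height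
      -- by `-ᴿ β i`.
      noCrossing -βᵢ≰0 (no ρ≰origin) =
        progression-unbounded (λ n → ⟨ backward n ∣ β ⟩) (-ᴿ β i) ρ -βᵢ≰0 backward-step
          (λ n → proj₁ (≰⇒> (backward-below ρ≰origin n)))

    -- Unimodularity excludes a zero `β`, since the transposed incidence matrix then has trivial
    -- kernel and `α` is nonzero.
    nonNegative⇒normal : Unimodular σ → NonNegative β → IsNormal β
    nonNegative⇒normal unimodular β≥0 =
      β≥0 , λ β≈0 → proj₂ α-normal (ᵀ·-injective (incidence σ) unimodular α β≈0)

    -- Both sides are the gradient of the same half-space indicator; normality of `β` gives this
    -- form to the right-hand side.
    dual≐steppedPlane : (β-normal : IsNormal β) → E₁* σ P ≐ steppedPlane β β-normal ρ
    dual≐steppedPlane β-normal x i =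
      trans (dual-steppedPlane x i) (sym (steppedPlane-gradient β β-normal ρ x i))

  steppedPlane-binary : ∀ {d} (α : ℝ^ d) α-normal ρ → Binary (steppedPlane α α-normal ρ)
  steppedPlane-binary α α-normal ρ x i
    with does ((⟨ x ∣ α ⟩ <? ρ) ×-dec (ρ ≤? ⟨ x ⊕ e i ∣ α ⟩))
  ... | true  = inj₂ refl
  ... | false = inj₁ refl

theorem4p5 : (ℝ : Reals) → let open SteppedPlanes ℝ in
  (d : ℕ) → 3 ≤ℕ d →
  (σ : Morphism d) → Unimodular σ →
  (α : ℝ^ d) (α-normal : IsNormal α) (ρ : Reals.Carrier ℝ) →
  let P  = steppedPlane α α-normal ρ
      β  = incidence σ ᵀ· α
      a  = Binary (E₁* σ P)
      b  = Σ (IsNormal β) (λ β-normal → E₁* σ P ≐ steppedPlane β β-normal ρ)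
      c  = NonNegative β
  in (a ⇔ b) × (b ⇔ c)
theorem4p5 ℝ d _ σ unimodular α α-normal ρ = mk⇔ (c⇒b ∘ a⇒c) b⇒a , mk⇔ (proj₁ ∘ proj₁) c⇒b
  where
  open SteppedPlanes ℝ
  open RealLemmas ℝ
  P = steppedPlane α α-normal ρ
  β = incidence σ ᵀ· α

  a⇒c : Binary (E₁* σ P) → NonNegative β
  a⇒c = binary⇒nonNegative σ α α-normal ρ

  c⇒b : NonNegative β → Σ (IsNormal β) (λ β-normal → E₁* σ P ≐ steppedPlane β β-normal ρ)
  c⇒b β≥0 = β-normal , dual≐steppedPlane σ α α-normal ρ β-normal
    where
    β-normal : IsNormal β
    β-normal = nonNegative⇒normal σ α α-normal ρ unimodular β≥0

  b⇒a : Σ (IsNormal β) (λ β-normal → E₁* σ P ≐ steppedPlane β β-normal ρ) → Binary (E₁* σ P)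
  b⇒a (β-normal , E≐plane) x i =
    subst (λ z → z ≡ 0ℤ ⊎ z ≡ 1ℤ) (sym (E≐plane x i)) (steppedPlane-binary β β-normal ρ x i)
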